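{- Let $G$ be a simple graph of order $n$ and let $m\ge 1$. Let $M$ be a maximum matching of $G$, $\alpha'(G)=|M|$, and let $l=n-2\alpha'(G)$ be the number of vertices of $G$ not covered by $M$. Then $s(G\circ \overline{K_m})=\alpha'(G)+l$. In particular, if $G$ has a perfect matching, then $s(G\circ\overline{K_m})=n/2$.
   Context: A matching in a graph is a set of edges no two of which share a vertex; it is maximal if it is not properly contained in another matching, and maximum if it has the largest possible size. $\alpha'(G)$ is the size of a maximum matching of $G$. The saturation number $s(G)$ is the minimum cardinality of a maximal matching of $G$. $\overline{K_m}$ is the edgeless graph on $m$ vertices. The corona $G_1\circ G_2$ of graphs $G_1$ and $G_2$ is obtained by taking one copy of $G_1$ and $|V(G_1)|$ disjoint copies of $G_2$, and joining the $i$-th vertex of $G_1$ by an edge to every vertex of the $i$-th copy of $G_2$. -}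

module Defs where

open import Data.Empty using (⊥)
open import Data.Fin.Base using (Fin)
open import Data.Fin.Properties as Fin using (_<?_; any?; +↔⊎; *↔×)
open import Data.Fin.Subset using (Subset; _∈_; _⊂_; ∣_∣)
open import Data.Fin.Subset.Properties using (_∈?_)
open import Data.List.Base using (List; map; filter; cartesianProduct; allFin; length; lookup)
open import Data.Nat.Base using (ℕ; _+_; _*_; _≤_)
open import Data.Product.Base using (_×_; _,_; ∃; proj₁; proj₂)
open import Data.Product.Function.NonDependent.Propositional using (_×-↔_)
open import Data.Sum.Base using (_⊎_; inj₁; inj₂)
open import Data.Sum.Function.Propositional using (_⊎-↔_)
open import Function.Bundles using (_↔_; Inverse)
open import Function.Construct.Identity using (↔-id)
open import Function.Properties.Inverse using (↔⇒↣; ↔-sym; ↔-trans)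
open import Level using (0ℓ)
open import Relation.Binary.Core using (Rel)
open import Relation.Binary.Definitions using (Decidable; DecidableEquality; Symmetric)
open import Relation.Binary.PropositionalEquality.Core using (_≡_; _≢_; sym)
open import Relation.Nullary using (¬_; Dec; no; ¬?; _×-dec_; _⊎-dec_)
open import Relation.Nullary.Decidable using (via-injection)

record Graph : Set₁ where
  infix 4 _~_ _~?_ _≟ᵥ_
  field
    order   : ℕ
    Vertex  : Set
    indexed : Vertex ↔ Fin order
    _~_     : Rel Vertex 0ℓ
    ~-sym   : Symmetric _~_
    ~-irr   : ∀ {v} → ¬ (v ~ v)
    _~?_    : Decidable _~_

  index : Vertex → Fin order
  index = Inverse.to indexed

  _≟ᵥ_ : DecidableEquality Vertex
  _≟ᵥ_ = via-injection (↔⇒↣ indexed) Fin._≟_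

  vertices : List Vertex
  vertices = map (Inverse.from indexed) (allFin order)

  -- Each edge {u , v} is listed exactly once, with the endpoint of smaller
  -- index first.
  edges : List (Vertex × Vertex)
  edges = filter (λ (u , v) → (index u <? index v) ×-dec (u ~? v))
                 (cartesianProduct vertices vertices)

  -- Edges are named by their position in the list above.
  Edge : Set
  Edge = Fin (length edges)

  EdgeSet : Set
  EdgeSet = Subset (length edges)

  ends : Edge → Vertex × Vertex
  ends = lookup edges

  _IncidentTo_ : Vertex → Edge → Set
  v IncidentTo e = v ≡ proj₁ (ends e) ⊎ v ≡ proj₂ (ends e)

  IsMatching : EdgeSet → Set
  IsMatching M = ∀ {e f} → e ∈ M → f ∈ M → e ≢ f →
                 ∀ v → ¬ (v IncidentTo e × v IncidentTo f)

  IsMaximalMatching : EdgeSet → Set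
  IsMaximalMatching M = IsMatching M × (∀ N → IsMatching N → ¬ (M ⊂ N))

  IsMaximumMatching : EdgeSet → Set
  IsMaximumMatching M = IsMatching M × (∀ N → IsMatching N → ∣ N ∣ ≤ ∣ M ∣)

  Covers : EdgeSet → Vertex → Set
  Covers M v = ∃ λ e → e ∈ M × v IncidentTo e

  covers? : ∀ M v → Dec (Covers M v)
  covers? M v = any? λ e →
    (e ∈? M) ×-dec ((v ≟ᵥ proj₁ (ends e)) ⊎-dec (v ≟ᵥ proj₂ (ends e)))

  uncovered : EdgeSet → List Vertex
  uncovered M = filter (λ v → ¬? (covers? M v)) vertices

  IsPerfectMatching : EdgeSet → Set
  IsPerfectMatching M = IsMatching M × (∀ v → Covers M v)

  HasPerfectMatching : Set
  HasPerfectMatching = ∃ IsPerfectMatching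

  IsSaturationNumber : ℕ → Set
  IsSaturationNumber s = (∃ λ M → IsMaximalMatching M × ∣ M ∣ ≡ s)
                       × (∀ M → IsMaximalMatching M → s ≤ ∣ M ∣)

open Graph

edgeless : ℕ → Graph
edgeless m = record
  { order   = m
  ; Vertex  = Fin m
  ; indexed = ↔-id (Fin m)
  ; _~_     = λ _ _ → ⊥
  ; ~-sym   = λ ()
  ; ~-irr   = λ ()
  ; _~?_    = λ _ _ → no λ ()
  }

-- inj₁ v is the vertex v of G; inj₂ (v , x) is the vertex x in the copy of H
-- attached to v.
module Corona (G H : Graph) where

  CVertex : Set
  CVertex = Vertex G ⊎ (Vertex G × Vertex H)

  CAdj : Rel CVertex 0ℓ
  CAdj (inj₁ u)       (inj₁ v)       = _~_ G u v
  CAdj (inj₁ u)       (inj₂ (v , _)) = u ≡ v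
  CAdj (inj₂ (u , _)) (inj₁ v)       = u ≡ v
  CAdj (inj₂ (u , x)) (inj₂ (v , y)) = u ≡ v × _~_ H x y

  CAdj-sym : Symmetric CAdj
  CAdj-sym {inj₁ _} {inj₁ _} p       = ~-sym G p
  CAdj-sym {inj₁ _} {inj₂ _} p       = sym p
  CAdj-sym {inj₂ _} {inj₁ _} p       = sym p
  CAdj-sym {inj₂ _} {inj₂ _} (p , q) = sym p , ~-sym H q

  CAdj-irr : ∀ {v} → ¬ CAdj v v
  CAdj-irr {inj₁ _} p       = ~-irr G p
  CAdj-irr {inj₂ _} (_ , q) = ~-irr H q

  CAdj? : Decidable CAdj
  CAdj? (inj₁ u)       (inj₁ v)       = _~?_ G u v
  CAdj? (inj₁ u)       (inj₂ (v , _)) = _≟ᵥ_ G u v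
  CAdj? (inj₂ (u , _)) (inj₁ v)       = _≟ᵥ_ G u v
  CAdj? (inj₂ (u , x)) (inj₂ (v , y)) = _≟ᵥ_ G u v ×-dec _~?_ H x y

infixl 7 _⊚_

_⊚_ : Graph → Graph → Graph
G ⊚ H = record
  { order   = order G + order G * order H
  ; Vertex  = CVertex
  ; indexed = ↔-trans (indexed G ⊎-↔ ↔-trans (indexed G ×-↔ indexed H) (↔-sym *↔×))
                      (↔-sym +↔⊎)
  ; _~_     = CAdj
  ; ~-sym   = λ {u} {v} → CAdj-sym {u} {v}
  ; ~-irr   = λ {v} → CAdj-irr {v}
  ; _~?_    = CAdj?
  }
  where open Corona G H

{-# OPTIONS --safe #-}

-- In a maximal matching N of the corona every vertex v of G is covered, since
-- otherwise v could be matched to one of its leaves.  If A is the set of edges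
-- of N inside G, counting the covered vertices of G gives n ≤ |N| + |A|, and A
-- is a matching of G, so |N| ≥ n - α′(G) = α′(G) + l.  Conversely, a maximum
-- matching of G together with one pendant edge at each vertex it leaves
-- uncovered is a maximal matching of size α′(G) + l.
module Submission where

open import Data.Bool.Base using (true)
open import Data.Fin.Base using (Fin; zero; suc) renaming (_<_ to _<ᶠ_)
open import Data.Fin.Properties using (toℕ-↑ˡ; toℕ-↑ʳ; toℕ<n; injective⇒≤; suc-injective) renaming (_≟_ to _≟ᶠ_)
open import Data.Fin.Subset using (Subset; inside; outside; ⁅_⁆; _∪_; _∈_; _⊂_; ∣_∣)
open import Data.Fin.Subset.Properties using (_∈?_; p⊆p∪q; q⊆p∪q; x∈⁅x⁆; x∈⁅y⁆⇒x≡y; x∈p∪q⁻)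
open import Data.List.Base using (List; []; _∷_; _++_; map; length; lookup; allFin; cartesianProduct)
open import Data.List.Membership.DecPropositional using () renaming (_∈?_ to member?)
open import Data.List.Membership.Propositional using () renaming (_∈_ to _∈ₗ_)
open import Data.List.Membership.Propositional.Properties using (∈-map⁺; ∈-map⁻; ∈-++⁺ˡ; ∈-++⁺ʳ; ∈-++⁻; ∈-filter⁺; ∈-filter⁻; ∈-cartesianProduct⁺; ∈-lookup; ∈-allFin)
open import Data.List.Properties using (length-map; length-++; length-tabulate; filter-none)
open import Data.List.Relation.Binary.Subset.Propositional using (_⊆_)
open import Data.List.Relation.Unary.All as All using ()
open import Data.List.Relation.Unary.All.Properties as All using ()
open import Data.List.Relation.Unary.AllPairs using ([]; _∷_)
open import Data.List.Relation.Unary.Any using (here; there) renaming (index to position)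
open import Data.List.Relation.Unary.Any.Properties using (lookup-index)
open import Data.List.Relation.Unary.Unique.Propositional using (Unique)
open import Data.List.Relation.Unary.Unique.Propositional.Properties using (map⁺; ++⁺; filter⁺; cartesianProduct⁺; allFin⁺)
open import Data.Nat.Base using (ℕ; suc; _+_; _*_; _∸_; _≤_; _<_; s≤s; _/_)
open import Data.Nat.Divisibility.Core using (_∣_; divides)
open import Data.Nat.DivMod using (m*n/n≡m)
open import Data.Nat.Properties using (≤-trans; ≤-antisym; ≤-reflexive; <-≤-trans; <-asym; m≤m+n; +-monoʳ-≤; +-cancelˡ-≤; *-cancelˡ-≤; *-comm; +-comm; +-assoc; +-identityʳ; m+n∸m≡n; module ≤-Reasoning)
open import Data.Product.Base using (_×_; _,_; ∃; proj₁; proj₂)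
open import Data.Sum.Base using (_⊎_; inj₁; inj₂)
open import Data.Sum.Properties using (inj₁-injective)
open import Data.Vec.Base using (tabulate; []; _∷_; here; there)
open import Data.Vec.Properties using (lookup∘tabulate; []=⇒lookup; lookup⇒[]=)
open import Function.Base using (_∘_)
open import Function.Bundles using (Inverse)
open import Relation.Binary.PropositionalEquality using (_≡_; _≢_; refl; sym; trans; cong; cong₂; subst; subst₂)
open import Relation.Nullary using (¬_; Dec; yes; no; contradiction; does)
open import Relation.Nullary.Decidable using (dec-true; decidable-stable)
open import Relation.Unary using (Decidable)
open import Defs

-- Lists without repetition, and subsets of Fin k

lookup-injective : ∀ {A : Set} {xs : List A} → Unique xs →
                   ∀ {i j} → lookup xs i ≡ lookup xs j → i ≡ j
lookup-injective (x∉ ∷ u) {zero}  {zero}  eq = refl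
lookup-injective (x∉ ∷ u) {zero}  {suc j} eq = contradiction eq (All.lookup x∉ (∈-lookup j))
lookup-injective (x∉ ∷ u) {suc i} {zero}  eq = contradiction (sym eq) (All.lookup x∉ (∈-lookup i))
lookup-injective (x∉ ∷ u) {suc i} {suc j} eq = cong suc (lookup-injective u eq)

-- Pigeonhole: sending a position of `xs` to the position of its entry in `ys` is injective when
-- `xs` has no repetition. All the counting below goes through this.
Unique-⊆⇒length≤ : ∀ {A : Set} {xs ys : List A} → Unique xs → xs ⊆ ys →
                   length xs ≤ length ys
Unique-⊆⇒length≤ {xs = xs} {ys} u xs⊆ys = injective⇒≤ {f = f} f-injective
  where
  f : Fin (length xs) → Fin (length ys)
  f i = position (xs⊆ys (∈-lookup i))
  f-injective : ∀ {i j} → f i ≡ f j → i ≡ j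
  f-injective {i} {j} eq = lookup-injective u
    (trans (lookup-index (xs⊆ys (∈-lookup i)))
    (trans (cong (lookup ys) eq) (sym (lookup-index (xs⊆ys (∈-lookup j))))))

-- Injectivity is asked only on the entries of `xs`, since `firstEnd` and `secondEnd` are to be
-- injective only on the edges of a matching.
map⁺-injectiveOn : ∀ {A B : Set} (f : A → B) {xs} →
                   (∀ {x y} → x ∈ₗ xs → y ∈ₗ xs → f x ≡ f y → x ≡ y) →
                   Unique xs → Unique (map f xs)
map⁺-injectiveOn f inj []       = []
map⁺-injectiveOn f inj (x∉ ∷ u) =
  All.map⁺ (All.tabulate λ y∈ eq → All.lookup x∉ y∈ (inj (here refl) (there y∈) eq))
  ∷ map⁺-injectiveOn f (λ x∈ y∈ → inj (there x∈) (there y∈)) u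

-- Turns cardinalities of subsets into lengths of lists, where the pigeonhole bound applies.
members : ∀ {k} → Subset k → List (Fin k)
members []            = []
members (inside  ∷ p) = zero ∷ map suc (members p)
members (outside ∷ p) = map suc (members p)

length-members : ∀ {k} (p : Subset k) → length (members p) ≡ ∣ p ∣
length-members []            = refl
length-members (inside  ∷ p) = cong suc (trans (length-map suc (members p)) (length-members p))
length-members (outside ∷ p) = trans (length-map suc (members p)) (length-members p)

∈-members⁺ : ∀ {k} {p : Subset k} {x} → x ∈ p → x ∈ₗ members p
∈-members⁺ here                          = here refl
∈-members⁺ {p = inside  ∷ p} (there x∈p) = there (∈-map⁺ suc (∈-members⁺ x∈p))
∈-members⁺ {p = outside ∷ p} (there x∈p) = ∈-map⁺ suc (∈-members⁺ x∈p)

∈-members⁻ : ∀ {k} (p : Subset k) {x} → x ∈ₗ members p → x ∈ p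
∈-members⁻ (inside ∷ p) (here refl) = here
∈-members⁻ (inside ∷ p) (there x∈) with _ , y∈ , refl ← ∈-map⁻ suc x∈ = there (∈-members⁻ p y∈)
∈-members⁻ (outside ∷ p) x∈ with _ , y∈ , refl ← ∈-map⁻ suc x∈ = there (∈-members⁻ p y∈)

members-unique : ∀ {k} (p : Subset k) → Unique (members p)
members-unique []            = []
members-unique (inside  ∷ p) =
  All.map⁺ (All.tabulate λ _ ()) ∷ map⁺ suc-injective (members-unique p)
members-unique (outside ∷ p) = map⁺ suc-injective (members-unique p)

module _ {k} {P : Fin k → Set} (P? : Decidable P) where

  comprehension : Subset k
  comprehension = tabulate (does ∘ P?)

  ∈-comprehension⁺ : ∀ {x} → P x → x ∈ comprehension
  ∈-comprehension⁺ {x} px = lookup⇒[]= x comprehension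
    (trans (lookup∘tabulate (does ∘ P?) x) (dec-true (P? x) px))

  ∈-comprehension⁻ : ∀ {x} → x ∈ comprehension → P x
  ∈-comprehension⁻ {x} x∈ = go (P? x) (trans (sym (lookup∘tabulate (does ∘ P?) x)) ([]=⇒lookup x∈))
    where
    go : (d : Dec (P x)) → does d ≡ true → P x
    go (yes px) _ = px

∣comprehension∣≤length : ∀ {k} {P : Fin k → Set} (P? : Decidable P) (xs : List (Fin k)) →
                         (∀ {x} → P x → x ∈ₗ xs) → ∣ comprehension P? ∣ ≤ length xs
∣comprehension∣≤length P? xs P⊆xs =
  subst (_≤ length xs) (length-members p)
    (Unique-⊆⇒length≤ (members-unique p) (P⊆xs ∘ ∈-comprehension⁻ P? ∘ ∈-members⁻ p))
  where p = comprehension P?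

-- Edges and matchings of a graph

module GraphProperties (G : Graph) where
  open Graph G

  vertices-unique : Unique vertices
  vertices-unique = map⁺ from-injective (allFin⁺ order)
    where
    from-injective : ∀ {i j} → Inverse.from indexed i ≡ Inverse.from indexed j → i ≡ j
    from-injective {i} {j} eq =
      trans (sym (Inverse.strictlyInverseˡ indexed i))
        (trans (cong index eq) (Inverse.strictlyInverseˡ indexed j))

  ∈-vertices : ∀ v → v ∈ₗ vertices
  ∈-vertices v = subst (_∈ₗ vertices) (Inverse.strictlyInverseʳ indexed v)
    (∈-map⁺ (Inverse.from indexed) (∈-allFin (index v)))

  length-vertices : length vertices ≡ order
  length-vertices = trans (length-map _ (allFin order)) (length-tabulate {n = order} (λ i → i))

  -- `edges` filters a product of repetition-free lists, so no pair occurs at two positions.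
  ends-injective : ∀ {e f} → ends e ≡ ends f → e ≡ f
  ends-injective = lookup-injective (filter⁺ _ (cartesianProduct⁺ vertices-unique vertices-unique))

  ends-ordered-adjacent : ∀ e → index (proj₁ (ends e)) <ᶠ index (proj₂ (ends e))
                              × proj₁ (ends e) ~ proj₂ (ends e)
  ends-ordered-adjacent e = proj₂ (∈-filter⁻ _ {xs = cartesianProduct vertices vertices} (∈-lookup {xs = edges} e))

  edgeBetween : ∀ u v → index u <ᶠ index v → u ~ v → ∃ λ e → ends e ≡ (u , v)
  edgeBetween u v u<v u~v = position uv∈ , sym (lookup-index uv∈)
    where
    uv∈ : (u , v) ∈ₗ edges
    uv∈ = ∈-filter⁺ _ (∈-cartesianProduct⁺ (∈-vertices u) (∈-vertices v)) (u<v , u~v)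

  firstEnd secondEnd : Edge → Vertex
  firstEnd  = proj₁ ∘ ends
  secondEnd = proj₂ ∘ ends

  ends-distinct : ∀ e → firstEnd e ≢ secondEnd e
  ends-distinct e eq = ~-irr (subst (firstEnd e ~_) (sym eq) (proj₂ (ends-ordered-adjacent e)))

  -- Positive form of `IsMatching`, which only refutes distinct edges; equality of edges is
  -- decidable, so the double negation can be removed.
  matching-unique : ∀ {M} → IsMatching M → ∀ {e f v} → e ∈ M → f ∈ M →
                    v IncidentTo e → v IncidentTo f → e ≡ f
  matching-unique matching {e} {f} {v} e∈M f∈M v∈e v∈f =
    decidable-stable (e ≟ᶠ f) λ e≢f → matching e∈M f∈M e≢f v (v∈e , v∈f)

  -- The first ends, the second ends and the uncovered vertices together list every vertex of the
  -- graph exactly once.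
  matching-count : ∀ M → IsMatching M → 2 * ∣ M ∣ + length (uncovered M) ≡ order
  matching-count M matching = trans (sym size) (trans length≡ length-vertices)
    where
    firsts seconds : List Vertex
    firsts  = map firstEnd (members M)
    seconds = map secondEnd (members M)

    all : List Vertex
    all = firsts ++ seconds ++ uncovered M

    size : length all ≡ 2 * ∣ M ∣ + length (uncovered M)
    size = trans (length-++ firsts) (trans (cong₂ _+_
      (trans (length-map _ (members M)) (length-members M))
      (trans (length-++ seconds) (cong (_+ length (uncovered M))
        (trans (length-map _ (members M)) (trans (length-members M) (sym (+-identityʳ _)))))))
      (sym (+-assoc ∣ M ∣ _ _)))

    in-firsts⇒covered : ∀ {v} → v ∈ₗ firsts → Covers M v
    in-firsts⇒covered v∈ with e , e∈ , refl ← ∈-map⁻ firstEnd v∈ = e , ∈-members⁻ M e∈ , inj₁ refl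

    in-seconds⇒covered : ∀ {v} → v ∈ₗ seconds → Covers M v
    in-seconds⇒covered v∈ with e , e∈ , refl ← ∈-map⁻ secondEnd v∈ = e , ∈-members⁻ M e∈ , inj₂ refl

    not-covered : ∀ {v} → v ∈ₗ uncovered M → ¬ Covers M v
    not-covered v∈ = proj₂ (∈-filter⁻ _ {xs = vertices} v∈)

    disjoint : ∀ {v} → ¬ (v ∈ₗ firsts × v ∈ₗ seconds ++ uncovered M)
    disjoint (v∈₁ , v∈₂) with ∈-++⁻ seconds v∈₂
    ... | inj₂ v∈u = not-covered v∈u (in-firsts⇒covered v∈₁)
    -- A vertex that is the first end of `e` and the second end of `f` forces `e` and `f` to
    -- coincide, which would make this edge a loop.
    ... | inj₁ v∈s with e , e∈ , refl ← ∈-map⁻ firstEnd v∈₁ | f , f∈ , eq ← ∈-map⁻ secondEnd v∈s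
      with refl ← matching-unique matching (∈-members⁻ M e∈) (∈-members⁻ M f∈) (inj₁ refl) (inj₂ eq)
      = ends-distinct e eq

    all-unique : Unique all
    all-unique = ++⁺
      (map⁺-injectiveOn firstEnd (λ x∈ y∈ eq →
        matching-unique matching (∈-members⁻ M x∈) (∈-members⁻ M y∈) (inj₁ refl) (inj₁ eq))
        (members-unique M))
      (++⁺
        (map⁺-injectiveOn secondEnd (λ x∈ y∈ eq →
          matching-unique matching (∈-members⁻ M x∈) (∈-members⁻ M y∈) (inj₂ refl) (inj₂ eq))
          (members-unique M))
        (filter⁺ _ vertices-unique)
        (λ (v∈s , v∈u) → not-covered v∈u (in-seconds⇒covered v∈s)))
      disjoint

    ∈-all : ∀ v → v ∈ₗ all
    ∈-all v with covers? M v
    ... | yes (e , e∈M , inj₁ refl) = ∈-++⁺ˡ (∈-map⁺ firstEnd (∈-members⁺ e∈M))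
    ... | yes (e , e∈M , inj₂ refl) = ∈-++⁺ʳ firsts (∈-++⁺ˡ (∈-map⁺ secondEnd (∈-members⁺ e∈M)))
    ... | no ¬cov = ∈-++⁺ʳ firsts (∈-++⁺ʳ seconds (∈-filter⁺ _ (∈-vertices v) ¬cov))

    length≡ : length all ≡ length vertices
    length≡ = ≤-antisym (Unique-⊆⇒length≤ all-unique (λ {v} _ → ∈-vertices v))
                        (Unique-⊆⇒length≤ vertices-unique (λ {v} _ → ∈-all v))

  -- If both ends were free, adding `e` would give a strictly larger matching.
  maximal⇒edge-covered : ∀ {M} → IsMaximalMatching M → ∀ e →
                         Covers M (firstEnd e) ⊎ Covers M (secondEnd e)
  maximal⇒edge-covered {M} (matching , maximal) e
    with covers? M (firstEnd e) | covers? M (secondEnd e)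
  ... | yes c | _     = inj₁ c
  ... | no _  | yes c = inj₂ c
  ... | no ¬c | no ¬d = contradiction M⊂N (maximal N N-matching)
    where
    N : EdgeSet
    N = M ∪ ⁅ e ⁆

    apart : ∀ {f v} → f ∈ M → v IncidentTo f → ¬ (v IncidentTo e)
    apart f∈M v∈f (inj₁ refl) = ¬c (_ , f∈M , v∈f)
    apart f∈M v∈f (inj₂ refl) = ¬d (_ , f∈M , v∈f)

    N-matching : IsMatching N
    N-matching {f} {g} f∈N g∈N f≢g v (v∈f , v∈g)
      with x∈p∪q⁻ M ⁅ e ⁆ f∈N | x∈p∪q⁻ M ⁅ e ⁆ g∈N
    ... | inj₁ f∈M | inj₁ g∈M = matching f∈M g∈M f≢g v (v∈f , v∈g)
    ... | inj₁ f∈M | inj₂ g∈e with refl ← x∈⁅y⁆⇒x≡y e g∈e = apart f∈M v∈f v∈g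
    ... | inj₂ f∈e | inj₁ g∈M with refl ← x∈⁅y⁆⇒x≡y e f∈e = apart g∈M v∈g v∈f
    ... | inj₂ f∈e | inj₂ g∈e = f≢g (trans (x∈⁅y⁆⇒x≡y e f∈e) (sym (x∈⁅y⁆⇒x≡y e g∈e)))

    M⊂N : M ⊂ N
    M⊂N = p⊆p∪q ⁅ e ⁆ , e , q⊆p∪q M ⁅ e ⁆ (x∈⁅x⁆ e) , λ e∈M → ¬c (e , e∈M , inj₁ refl)

  -- A new edge of a larger matching would meet an edge of `M` at its first end. First ends suit the
  -- corona, where they always lie in `G`.
  covers-firstEnd⇒maximal : ∀ {M} → IsMatching M → (∀ e → Covers M (firstEnd e)) →
                         IsMaximalMatching M
  covers-firstEnd⇒maximal matching covered = matching , λ N N-matching (M⊆N , e , e∈N , e∉M) →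
    let f , f∈M , v∈f = covered e
    in N-matching e∈N (M⊆N f∈M) (λ e≡f → e∉M (subst (_∈ _) (sym e≡f) f∈M)) (firstEnd e) (inj₁ refl , v∈f)

  perfect⇒uncovered-empty : ∀ {M} → IsPerfectMatching M → uncovered M ≡ []
  perfect⇒uncovered-empty (_ , covered) =
    filter-none _ {xs = vertices} (All.tabulate λ {v} _ ¬c → ¬c (covered v))

  perfect⇒order : ∀ {M} → IsPerfectMatching M → order ≡ 2 * ∣ M ∣
  perfect⇒order {M} perfect = trans (sym (matching-count M (proj₁ perfect)))
    (trans (cong (λ us → 2 * ∣ M ∣ + length us) (perfect⇒uncovered-empty perfect))
           (+-identityʳ _))

  -- By `matching-count`, twice the size of any matching is at most `order`, which is twice the size
  -- of `M`.
  perfect⇒maximum : ∀ {M} → IsPerfectMatching M → IsMaximumMatching M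
  perfect⇒maximum {M} perfect = proj₁ perfect , λ N N-matching → *-cancelˡ-≤ 2
    (≤-trans (m≤m+n (2 * ∣ N ∣) (length (uncovered N)))
      (≤-reflexive (trans (matching-count N N-matching) (perfect⇒order perfect))))

-- The corona with an edgeless graph

module PendantCorona (G : Graph) (m : ℕ) where
  open Graph G
  open GraphProperties G

  -- The successor encodes that there is at least one leaf at each vertex; leaf `zero` is the one
  -- used by `pendantEdge`.
  C : Graph
  C = G ⊚ edgeless (suc m)

  module C  = Graph C
  module CP = GraphProperties C

  -- Classification of the edges of the corona

  index-inj₁-mono : ∀ {u v} → index u <ᶠ index v → C.index (inj₁ u) <ᶠ C.index (inj₁ v)
  index-inj₁-mono {u} {v} =
    subst₂ _<_ (sym (toℕ-↑ˡ (index u) _)) (sym (toℕ-↑ˡ (index v) _))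

  index-inj₁-cancel : ∀ {u v} → C.index (inj₁ u) <ᶠ C.index (inj₁ v) → index u <ᶠ index v
  index-inj₁-cancel {u} {v} = subst₂ _<_ (toℕ-↑ˡ (index u) _) (toℕ-↑ˡ (index v) _)

  index-inj₁<inj₂ : ∀ u w → C.index (inj₁ u) <ᶠ C.index (inj₂ w)
  index-inj₁<inj₂ u w = subst₂ _<_ (sym (toℕ-↑ˡ (index u) _)) (sym (toℕ-↑ʳ order _))
    (<-≤-trans (toℕ<n (index u)) (m≤m+n order _))

  -- Two shapes suffice: the indexing puts all vertices of `G` before all leaves, so a pendant edge
  -- is listed with its end in `G` first, and leaves are pairwise non-adjacent.
  data CoronaEnds : C.Vertex × C.Vertex → Set where
    inner   : ∀ {u v} → index u <ᶠ index v → u ~ v → CoronaEnds (inj₁ u , inj₁ v)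
    pendant : ∀ u x → CoronaEnds (inj₁ u , inj₂ (u , x))

  coronaEnds : ∀ e → CoronaEnds (C.ends e)
  coronaEnds e = classify (C.ends e) (CP.ends-ordered-adjacent e)
    where
    classify : ∀ ((a , b) : C.Vertex × C.Vertex) →
               C.index a <ᶠ C.index b × a C.~ b → CoronaEnds (a , b)
    classify (inj₁ u , inj₁ v)       (u<v , u~v)  = inner (index-inj₁-cancel u<v) u~v
    classify (inj₁ u , inj₂ (_ , x)) (_   , refl) = pendant u x
    classify (inj₂ w , inj₁ v)       (w<v , _)    = contradiction w<v (<-asym (index-inj₁<inj₂ v w))
    classify (inj₂ _ , inj₂ _)       (_   , _ , ())

  -- Edges of `G` inside the corona, and a chosen pendant edge at each vertex

  liftEdge : Edge → C.Edge
  liftEdge e = let u<v , u~v = ends-ordered-adjacent e in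
    proj₁ (CP.edgeBetween (inj₁ (firstEnd e)) (inj₁ (secondEnd e)) (index-inj₁-mono u<v) u~v)

  ends-liftEdge : ∀ e → C.ends (liftEdge e) ≡ (inj₁ (firstEnd e) , inj₁ (secondEnd e))
  ends-liftEdge e = let u<v , u~v = ends-ordered-adjacent e in
    proj₂ (CP.edgeBetween (inj₁ (firstEnd e)) (inj₁ (secondEnd e)) (index-inj₁-mono u<v) u~v)

  liftEdge-injective : ∀ {e f} → liftEdge e ≡ liftEdge f → e ≡ f
  liftEdge-injective {e} {f} eq = ends-injective (cong₂ _,_
    (inj₁-injective (cong proj₁ ends≡)) (inj₁-injective (cong proj₂ ends≡)))
    where ends≡ = trans (sym (ends-liftEdge e)) (trans (cong C.ends eq) (ends-liftEdge f))

  liftEdge-incident⁺ : ∀ {v} e → v IncidentTo e → inj₁ v C.IncidentTo liftEdge e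
  liftEdge-incident⁺ e (inj₁ refl) = inj₁ (sym (cong proj₁ (ends-liftEdge e)))
  liftEdge-incident⁺ e (inj₂ refl) = inj₂ (sym (cong proj₂ (ends-liftEdge e)))

  liftEdge-incident⁻ : ∀ {w} e → w C.IncidentTo liftEdge e →
                       ∃ λ v → w ≡ inj₁ v × v IncidentTo e
  liftEdge-incident⁻ e (inj₁ eq) = _ , trans eq (cong proj₁ (ends-liftEdge e)) , inj₁ refl
  liftEdge-incident⁻ e (inj₂ eq) = _ , trans eq (cong proj₂ (ends-liftEdge e)) , inj₂ refl

  pendantEdge : Vertex → C.Edge
  pendantEdge v = proj₁ (CP.edgeBetween (inj₁ v) (inj₂ (v , zero)) (index-inj₁<inj₂ v (v , zero)) refl)

  ends-pendantEdge : ∀ v → C.ends (pendantEdge v) ≡ (inj₁ v , inj₂ (v , zero))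
  ends-pendantEdge v = proj₂ (CP.edgeBetween (inj₁ v) (inj₂ (v , zero)) (index-inj₁<inj₂ v (v , zero)) refl)

  pendantEdge-incident⁻ : ∀ {w} v → w C.IncidentTo pendantEdge v →
                          w ≡ inj₁ v ⊎ w ≡ inj₂ (v , zero)
  pendantEdge-incident⁻ v (inj₁ eq) = inj₁ (trans eq (cong proj₁ (ends-pendantEdge v)))
  pendantEdge-incident⁻ v (inj₂ eq) = inj₂ (trans eq (cong proj₂ (ends-pendantEdge v)))

  leaf-covered⇒covered : ∀ {N v x} → C.Covers N (inj₂ (v , x)) → C.Covers N (inj₁ v)
  leaf-covered⇒covered {N} {v} {x} (e , e∈N , v∈e) = e , e∈N , inj₁ (go (coronaEnds e) v∈e)
    where
    go : ∀ {ab} → CoronaEnds ab → inj₂ (v , x) ≡ proj₁ ab ⊎ inj₂ (v , x) ≡ proj₂ ab →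
         inj₁ v ≡ proj₁ ab
    go (inner _ _)   (inj₁ ())
    go (inner _ _)   (inj₂ ())
    go (pendant _ _) (inj₂ refl) = refl

  -- Some end of the pendant edge at `v` is covered; if it is the leaf, the edge covering it also
  -- ends at `v`, the only neighbour of that leaf.
  maximal⇒covers-base : ∀ {N} → C.IsMaximalMatching N → ∀ v → C.Covers N (inj₁ v)
  maximal⇒covers-base {N} maximal v with CP.maximal⇒edge-covered maximal (pendantEdge v)
  ... | inj₁ c = subst (C.Covers N) (cong proj₁ (ends-pendantEdge v)) c
  ... | inj₂ c = leaf-covered⇒covered (subst (C.Covers N) (cong proj₂ (ends-pendantEdge v)) c)

  -- Lower bound on maximal matchings of the corona

  restriction? : ∀ N → Decidable (λ e → liftEdge e ∈ N)
  restriction? N e = liftEdge e ∈? N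

  -- The part of `N` inside `G`, pulled back along `liftEdge` so that its size can be compared with
  -- that of a maximum matching of `G`.
  restriction : C.EdgeSet → EdgeSet
  restriction N = comprehension (restriction? N)

  restriction-matching : ∀ {N} → C.IsMatching N → IsMatching (restriction N)
  restriction-matching {N} matching {e} {f} e∈ f∈ e≢f v (v∈e , v∈f) =
    matching (∈-comprehension⁻ (restriction? N) e∈) (∈-comprehension⁻ (restriction? N) f∈) (e≢f ∘ liftEdge-injective)
      (inj₁ v) (liftEdge-incident⁺ e v∈e , liftEdge-incident⁺ f v∈f)

  -- The vertices of G are among the first ends of the edges of N and the
  -- second ends of those edges of N that lie in G.
  order≤ : ∀ {N} → C.IsMaximalMatching N → order ≤ ∣ N ∣ + ∣ restriction N ∣
  order≤ {N} maximal = subst₂ _≤_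
    (trans (length-map _ vertices) length-vertices)
    (trans (length-++ firsts) (cong₂ _+_
      (trans (length-map _ (members N)) (length-members N))
      (trans (length-map _ (members A)) (length-members A))))
    (Unique-⊆⇒length≤ (map⁺ inj₁-injective vertices-unique) base⊆)
    where
    A = restriction N

    firsts seconds : List C.Vertex
    firsts  = map CP.firstEnd (members N)
    seconds = map (inj₁ ∘ secondEnd) (members A)

    -- A second end of the form `inj₁ v` rules out a pendant edge, so `e` is the lift of an edge `f`
    -- of `G`, and `f` lies in `A`.
    in-seconds : ∀ {v e} → e ∈ N → ∀ {ab} → C.ends e ≡ ab → CoronaEnds ab →
                 inj₁ v ≡ proj₂ ab → inj₁ v ∈ₗ seconds
    in-seconds {v} {e} e∈N ends≡ (inner {u} u<v u~v) refl =
      let f , f-ends = edgeBetween u v u<v u~v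
          lift≡ : liftEdge f ≡ e
          lift≡ = CP.ends-injective (trans (ends-liftEdge f)
            (trans (cong (λ (a , b) → inj₁ a , inj₁ b) f-ends) (sym ends≡)))
      in subst (_∈ₗ seconds) (cong (inj₁ ∘ proj₂) f-ends)
           (∈-map⁺ (inj₁ ∘ secondEnd)
             (∈-members⁺ (∈-comprehension⁺ (restriction? N) (subst (_∈ N) (sym lift≡) e∈N))))

    base⊆ : map inj₁ vertices ⊆ firsts ++ seconds
    base⊆ w∈ with v , _ , refl ← ∈-map⁻ inj₁ w∈ with maximal⇒covers-base maximal v
    ... | e , e∈N , inj₁ eq = ∈-++⁺ˡ (subst (_∈ₗ firsts) (sym eq) (∈-map⁺ CP.firstEnd (∈-members⁺ e∈N)))
    ... | e , e∈N , inj₂ eq = ∈-++⁺ʳ firsts (in-seconds e∈N refl (coronaEnds e) eq)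

  -- Both bounds on `order` are compared after adding a copy of `∣ M ∣` to each side: one counts the
  -- vertices of `G` through `M`, the other through `N` and its restriction, which is no larger than
  -- `M`.
  saturation-lower : ∀ {M} → IsMaximumMatching M → ∀ N → C.IsMaximalMatching N →
                     ∣ M ∣ + length (uncovered M) ≤ ∣ N ∣
  saturation-lower {M} (matching , maximum) N maximal = +-cancelˡ-≤ ∣ M ∣ _ _ (begin
    ∣ M ∣ + (∣ M ∣ + l)         ≡⟨ +-assoc ∣ M ∣ ∣ M ∣ l ⟨
    ∣ M ∣ + ∣ M ∣ + l           ≡⟨ cong (λ k → ∣ M ∣ + k + l) (+-identityʳ ∣ M ∣) ⟨
    2 * ∣ M ∣ + l               ≡⟨ matching-count M matching ⟩
    order                       ≤⟨ order≤ maximal ⟩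
    ∣ N ∣ + ∣ restriction N ∣   ≤⟨ +-monoʳ-≤ ∣ N ∣ (maximum (restriction N) (restriction-matching (proj₁ maximal))) ⟩
    ∣ N ∣ + ∣ M ∣               ≡⟨ +-comm ∣ N ∣ ∣ M ∣ ⟩
    ∣ M ∣ + ∣ N ∣               ∎)
    where
    open ≤-Reasoning
    l = length (uncovered M)

  -- A matching of `G` completed by pendant edges

  module Extension {M : EdgeSet} (matching : IsMatching M) where

    extensionList : List C.Edge
    extensionList = map liftEdge (members M) ++ map pendantEdge (uncovered M)

    extension? : Decidable (_∈ₗ extensionList)
    extension? e = member? _≟ᶠ_ e extensionList

    extension : C.EdgeSet
    extension = comprehension extension?

    ∣extension∣≤ : ∣ extension ∣ ≤ ∣ M ∣ + length (uncovered M)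
    ∣extension∣≤ = subst (∣ extension ∣ ≤_)
      (trans (length-++ (map liftEdge (members M)))
        (cong₂ _+_ (trans (length-map liftEdge (members M)) (length-members M))
                   (length-map pendantEdge (uncovered M))))
      (∣comprehension∣≤length extension? extensionList (λ e∈ → e∈))

    -- Records the origin of an edge of `extension`, so that the matching property becomes a check
    -- of four cases.
    data Extended : C.Edge → Set where
      lifted : ∀ {e} → e ∈ M → Extended (liftEdge e)
      added  : ∀ {v} → ¬ Covers M v → Extended (pendantEdge v)

    extended : ∀ {e} → e ∈ extension → Extended e
    extended e∈ with ∈-++⁻ (map liftEdge (members M)) (∈-comprehension⁻ extension? e∈)
    ... | inj₁ e∈₁ with _ , f∈ , refl ← ∈-map⁻ liftEdge e∈₁ = lifted (∈-members⁻ M f∈)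
    ... | inj₂ e∈₂ with _ , v∈ , refl ← ∈-map⁻ pendantEdge e∈₂ =
      added (proj₂ (∈-filter⁻ _ {xs = vertices} v∈))

    -- A lifted edge has both ends in `G`, so it could meet the pendant edge only at `v`, which
    -- would then be covered by `M`.
    lifted-added-apart : ∀ {e v w} → e ∈ M → ¬ Covers M v →
      w C.IncidentTo liftEdge e → ¬ (w C.IncidentTo pendantEdge v)
    lifted-added-apart {e} {v} e∈M ¬c w∈e w∈v
      with _ , refl , u∈e ← liftEdge-incident⁻ e w∈e | pendantEdge-incident⁻ v w∈v
    ... | inj₁ refl = ¬c (e , e∈M , u∈e)

    extended-unique : ∀ {e f w} → Extended e → Extended f →
      w C.IncidentTo e → w C.IncidentTo f → e ≡ f
    extended-unique (lifted {e} e∈M) (lifted {f} f∈M) w∈e w∈f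
      with _ , refl , v∈e ← liftEdge-incident⁻ e w∈e | _ , refl , v∈f ← liftEdge-incident⁻ f w∈f =
      cong liftEdge (matching-unique matching e∈M f∈M v∈e v∈f)
    extended-unique (lifted e∈M) (added ¬c) w∈e w∈v =
      contradiction w∈v (lifted-added-apart e∈M ¬c w∈e)
    extended-unique (added ¬c) (lifted e∈M) w∈v w∈e =
      contradiction w∈v (lifted-added-apart e∈M ¬c w∈e)
    -- Either end of a pendant edge determines its vertex in `G`; a shared vertex cannot be both a
    -- leaf and in `G`.
    extended-unique (added {u} _) (added {v} _) w∈u w∈v
      with pendantEdge-incident⁻ u w∈u | pendantEdge-incident⁻ v w∈v
    ... | inj₁ refl | inj₁ refl = refl
    ... | inj₂ refl | inj₂ refl = refl

    covers-base : ∀ v → C.Covers extension (inj₁ v)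
    covers-base v with covers? M v
    ... | yes (e , e∈M , v∈e) =
      liftEdge e
      , ∈-comprehension⁺ extension? (∈-++⁺ˡ (∈-map⁺ liftEdge (∈-members⁺ e∈M)))
      , liftEdge-incident⁺ e v∈e
    ... | no ¬c =
      pendantEdge v
      , ∈-comprehension⁺ extension? (∈-++⁺ʳ (map liftEdge (members M))
          (∈-map⁺ pendantEdge (∈-filter⁺ _ (∈-vertices v) ¬c)))
      , inj₁ (sym (cong proj₁ (ends-pendantEdge v)))

    covers-firstEnd : ∀ e → C.Covers extension (CP.firstEnd e)
    covers-firstEnd e = go (coronaEnds e)
      where
      go : ∀ {ab} → CoronaEnds ab → C.Covers extension (proj₁ ab)
      go (inner {u} _ _) = covers-base u
      go (pendant u _)   = covers-base u

    extension-maximal : C.IsMaximalMatching extension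
    extension-maximal = CP.covers-firstEnd⇒maximal
      (λ e∈ f∈ e≢f w (w∈e , w∈f) → e≢f (extended-unique (extended e∈) (extended f∈) w∈e w∈f))
      covers-firstEnd

  saturation : ∀ {M} → IsMaximumMatching M →
               C.IsSaturationNumber (∣ M ∣ + length (uncovered M))
  saturation maximum =
    ( extension , extension-maximal
    -- The size of `extension` is bounded directly only from above; the other inequality is the
    -- lower bound applied to `extension` itself.
    , ≤-antisym ∣extension∣≤ (saturation-lower maximum extension extension-maximal))
    , saturation-lower maximum
    where open Extension (proj₁ maximum)

theorem2p2 : (G : Graph) (m : ℕ) → 1 ≤ m →
    let n = Graph.order G in
    ((M : Graph.EdgeSet G) → Graph.IsMaximumMatching G M →
      let α′ = ∣ M ∣
          l  = n ∸ 2 * α′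
      in  length (Graph.uncovered G M) ≡ l
        × Graph.IsSaturationNumber (G ⊚ edgeless m) (α′ + l))
    × (Graph.HasPerfectMatching G →
        2 ∣ n × Graph.IsSaturationNumber (G ⊚ edgeless m) (n / 2))
-- Matching on `1 ≤ m` exposes the successor expected by `PendantCorona`.
theorem2p2 G (suc m) (s≤s _) =
    (λ M maximum → let l≡ = uncovered-count M (proj₁ maximum) in
      l≡ , subst (λ l → C.IsSaturationNumber (∣ M ∣ + l)) l≡ (saturation maximum))
  , λ (M , perfect) →
      -- The order is written as `∣ M ∣ * 2`, the form used both for divisibility and for evaluating
      -- `n / 2`.
      let n≡ = trans (perfect⇒order perfect) (*-comm 2 ∣ M ∣)
          s≡ = trans (trans (cong (λ us → ∣ M ∣ + length us) (perfect⇒uncovered-empty perfect))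
                            (+-identityʳ ∣ M ∣))
                     (sym (trans (cong (_/ 2) n≡) (m*n/n≡m ∣ M ∣ 2)))
      in divides ∣ M ∣ n≡ , subst C.IsSaturationNumber s≡ (saturation (perfect⇒maximum perfect))
  where
  open Graph G
  open GraphProperties G
  open PendantCorona G m

  uncovered-count : ∀ M → IsMatching M → length (uncovered M) ≡ order ∸ 2 * ∣ M ∣
  -- The subtraction is never truncated: by `matching-count`, `order` is `2 * ∣ M ∣` plus the number
  -- of uncovered vertices.
  uncovered-count M matching = trans (sym (m+n∸m≡n (2 * ∣ M ∣) _))
    (cong (_∸ 2 * ∣ M ∣) (matching-count M matching))
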